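{- Let $(\mathcal{X},d)$ be a finite metric space, $\mathcal{P} = \{P_1,\dots,P_t\}$ a partition of $\mathcal{X}$, and $T_1,\dots,T_t$ spanning trees of $P_1,\dots,P_t$ respectively. Let $T^*$ be the spanning tree of $G_\mathcal{X}$ given by an optimal solution of the Metric Forest Completion problem on this input, and let $\hat{T}$ be the spanning tree returned by the algorithm MFC-Approx on this input. Then $$w_\mathcal{X}(T^*) \leq w_\mathcal{X}(\hat{T}) \leq \beta\, w_\mathcal{X}(T^*)$$ for $\beta = (3+\sqrt{5})/2 < 2.62$.
   Context: Setting. $(\mathcal{X},d)$ is a finite metric space. The complete graph $G_\mathcal{X}$ has node set $\mathcal{X}$, all pairs of points as edges, and edge weights $w_\mathcal{X}(x,y) = d(x,y)$. For a set $F$ of edges (or a graph with edge set $F$), $w_\mathcal{X}(F) = \sum_{e\in F} w_\mathcal{X}(e)$. Metric Forest Completion (MFC). The input is a partition $\mathcal{P} = \{P_1,\dots,P_t\}$ of $\mathcal{X}$ into disjoint nonempty components and, for each $i$, a spanning tree $T_i = (P_i,E_{T_i})$ of $P_i$ (an arbitrary tree on the node set $P_i$, not necessarily of minimum weight). Let $E_t = \bigcup_{i=1}^t E_{T_i}$, and let $\mathcal{I}$ be the set of edges of $G_\mathcal{X}$ joining points in different components. The problem is to minimize $w_\mathcal{X}(M) + w_\mathcal{X}(E_t)$ over all sets $M \subseteq \mathcal{I}$ such that $(\mathcal{X}, M\cup E_t)$ is connected. Let $M^*$ be an optimal $M$ corresponding to an MST of the complete graph on component nodes $v_1,\dots,v_t$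 with edge weights $w^*_{ij} = \min_{x\in P_i, y\in P_j} d(x,y)$ (each edge $(v_i,v_j)$ of the MST being replaced by a closest pair between $P_i$ and $P_j$); $T^* = (\mathcal{X}, E_t\cup M^*)$. Algorithm MFC-Approx. (1) For each $i$, choose an arbitrary representative $s_i \in P_i$. (2) For each pair $i\neq j$, compute $w_{i\to j} = \min_{x\in P_i} d(x,s_j)$, $w_{j\to i} = \min_{x\in P_j} d(x,s_i)$, and $\hat{w}_{ij} = \min\{w_{i\to j}, w_{j\to i}\}$, recording a pair of points (one in $P_i$, one in $P_j$) at distance $\hat{w}_{ij}$ that attains this minimum. (3) Compute a minimum spanning tree $\hat{T}_\mathcal{P}$ of the complete graph on $v_1,\dots,v_t$ with edge weights $\hat{w}_{ij}$. (4) Let $\hat{M}$ be the set of recorded point pairs corresponding to the edges of $\hat{T}_\mathcal{P}$, and return $\hat{T} = (\mathcal{X}, E_t\cup \hat{M})$. All choices and ties are arbitrary. -}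

module Defs where

open import Level using (0ℓ; _⊔_) renaming (suc to lsuc)
open import Algebra.Core using (Op₁; Op₂)
open import Algebra.Apartness.Structures using (IsHeytingField)
import Algebra.Definitions.RawMonoid as Multiples
open import Algebra.Bundles using (CommutativeRing)
open import Algebra.Definitions using (Invertible)
open import Data.Bool.Base using (if_then_else_)
open import Data.Fin.Base using (Fin; _<_)
open import Data.Fin.Properties using (_≟_; _<?_; any?; <⇒≢)
open import Data.Fin.Subset using (Subset; _∈_; Nonempty; ⊤)
open import Data.List.Base using (List; _∷_; _∷ʳ_; length)
open import Data.List.Relation.Unary.Linked using (Linked)
open import Data.List.Relation.Unary.Unique.Propositional using (Unique)
import Data.Nat.Base as ℕ
open import Data.Nat.Base using (ℕ; zero; suc; NonZero)
open import Data.Product.Base using (∃-syntax; ∃₂; _×_; _,_; proj₁; proj₂)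
open import Data.Product.Properties using (≡-dec)
open import Data.Sum.Base using (_⊎_; inj₁; inj₂; [_,_]; swap) renaming (map to map-⊎)
open import Function.Metric.Structures using (IsGeneralMetric)
open import Relation.Binary.Construct.Closure.ReflexiveTransitive using (Star)
open import Relation.Binary.Core using (Rel)
open import Relation.Binary.Definitions using (Decidable; Symmetric; Irreflexive)
open import Relation.Binary.PropositionalEquality using (_≡_; _≢_; refl; cong; subst)
open import Relation.Binary.Structures using (IsStrictPartialOrder)
open import Relation.Nullary using (¬_)
open import Relation.Nullary.Decidable using (does; _×-dec_; _⊎-dec_)
open import Relation.Unary using (Pred)

record OrderedField c ℓ₁ ℓ₂ : Set (lsuc (c ⊔ ℓ₁ ⊔ ℓ₂)) where
  infix  8 -_
  infixl 7 _*_ _/_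
  infixl 6 _+_
  infix  4 _≈_ _<ʳ_ _≤ʳ_
  field
    Carrier : Set c
    _≈_     : Rel Carrier ℓ₁
    _<ʳ_    : Rel Carrier ℓ₂
    _+_ _*_ : Op₂ Carrier
    -_      : Op₁ Carrier
    0# 1#   : Carrier

    -- The apartness relation of the field is  x < y or y < x; tightness
    -- and cotransitivity of the order are part of this axiom.
    isHeytingField       : IsHeytingField _≈_ (λ x y → x <ʳ y ⊎ y <ʳ x) _+_ _*_ -_ 0# 1#
    isStrictPartialOrder : IsStrictPartialOrder _≈_ _<ʳ_
    0<1                  : 0# <ʳ 1#
    +-monoʳ-<            : ∀ z {x y} → x <ʳ y → z + x <ʳ z + y
    *-positive           : ∀ {x y} → 0# <ʳ x → 0# <ʳ y → 0# <ʳ x * y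

  open IsHeytingField isHeytingField public using (isCommutativeRing; #⇒invertible)

  commutativeRing : CommutativeRing c ℓ₁
  commutativeRing = record { isCommutativeRing = isCommutativeRing }

  open Multiples (CommutativeRing.+-rawMonoid commutativeRing) public using (sum)

  fromℕ : ℕ → Carrier
  fromℕ n = n · 1#
    where open Multiples (CommutativeRing.+-rawMonoid commutativeRing) renaming (_×_ to _·_)

  _≤ʳ_ : Rel Carrier ℓ₂
  x ≤ʳ y = ¬ (y <ʳ x)

  fromℕ-positive : ∀ n .{{_ : NonZero n}} → 0# <ʳ fromℕ n
  fromℕ-positive (suc n) = go n
    where
    open IsStrictPartialOrder isStrictPartialOrder
      using (<-respʳ-≈) renaming (trans to <-trans)
    open CommutativeRing commutativeRing using (+-identityʳ) renaming (sym to ≈-sym)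
    go : ∀ n → 0# <ʳ fromℕ (suc n)
    go zero    = <-respʳ-≈ (≈-sym (+-identityʳ 1#)) 0<1
    go (suc n) = <-trans (<-respʳ-≈ (≈-sym (+-identityʳ 1#)) 0<1)
                         (+-monoʳ-< 1# (go n))

  -- The inverse is stated for n - 0 because the field axiom inverts
  -- differences of apart elements.
  fromℕ-invertible : ∀ n .{{_ : NonZero n}} →
                     Invertible _≈_ 1# _*_ (fromℕ n + (- 0#))
  fromℕ-invertible n = #⇒invertible (inj₂ (fromℕ-positive n))

  _/_ : Carrier → (n : ℕ) .{{_ : NonZero n}} → Carrier
  x / n = x * proj₁ (fromℕ-invertible n)

  IsSqrt : Carrier → Carrier → Set (ℓ₁ ⊔ ℓ₂)
  IsSqrt x r = (0# ≤ʳ r) × (r * r ≈ x)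

  IsLeast : ∀ {ℓ} → Pred Carrier ℓ → Pred Carrier (c ⊔ ℓ₂ ⊔ ℓ)
  IsLeast S m = S m × (∀ v → S v → m ≤ʳ v)

------------------------------------------------------------------------
-- The real numbers, as a Cauchy-complete Archimedean ordered field.
-- Classically these axioms determine ℝ up to isomorphism.  Neither
-- trichotomy nor decidability of the order is assumed, so constructive
-- models of the reals satisfy them as well.

record Reals c ℓ₁ ℓ₂ : Set (lsuc (c ⊔ ℓ₁ ⊔ ℓ₂)) where
  field
    orderedField : OrderedField c ℓ₁ ℓ₂

  open OrderedField orderedField public

  field
    archimedean : ∀ x → ∃[ n ] x <ʳ fromℕ n
    complete    : (a : ℕ → Carrier) →
                  (∀ ε → 0# <ʳ ε → ∃[ N ] ∀ m n → N ℕ.≤ m → N ℕ.≤ n → a m <ʳ a n + ε) →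
                  ∃[ l ] ∀ ε → 0# <ʳ ε →
                    ∃[ N ] ∀ m → N ℕ.≤ m → (a m <ʳ l + ε) × (l <ʳ a m + ε)

------------------------------------------------------------------------
-- Finite simple graphs on the node set Fin n; these also serve as sets
-- of (undirected) edges of the complete graph.

record Graph (n : ℕ) : Set₁ where
  field
    Adj    : Rel (Fin n) 0ℓ
    adj?   : Decidable Adj
    sym    : Symmetric Adj
    irrefl : Irreflexive _≡_ Adj

open Graph using (Adj; adj?)

module _ {n : ℕ} where

  infixl 6 _∪_
  _∪_ : Graph n → Graph n → Graph n
  G ∪ H = record
    { Adj    = λ x y → Adj G x y ⊎ Adj H x y
    ; adj?   = λ x y → adj? G x y ⊎-dec adj? H x y
    ; sym    = map-⊎ (Graph.sym G) (Graph.sym H)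
    ; irrefl = λ eq → [ Graph.irrefl G eq , Graph.irrefl H eq ]
    }

  ⋃ : ∀ {t} → (Fin t → Graph n) → Graph n
  ⋃ G = record
    { Adj    = λ x y → ∃[ i ] Adj (G i) x y
    ; adj?   = λ x y → any? (λ i → adj? (G i) x y)
    ; sym    = λ (i , e) → i , Graph.sym (G i) e
    ; irrefl = λ eq (i , e) → Graph.irrefl (G i) eq e
    }

  ConnectedOn : Subset n → Graph n → Set
  ConnectedOn S G = ∀ {x y} → x ∈ S → y ∈ S → Star (Adj G) x y

  -- x ∷ vs lists the distinct nodes of a cycle, of which there are at
  -- least three.
  IsCycle : Graph n → Fin n → List (Fin n) → Set
  IsCycle G x vs = 2 ℕ.≤ length vs × Unique (x ∷ vs) × Linked (Adj G) (x ∷ vs ∷ʳ x)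

  record IsTreeOn (S : Subset n) (G : Graph n) : Set where
    field
      within    : ∀ {x y} → Adj G x y → x ∈ S × y ∈ S
      connected : ConnectedOn S G
      acyclic   : ∀ x vs → ¬ IsCycle G x vs

  record IsPartition {t} (P : Fin t → Subset n) : Set where
    field
      nonempty : ∀ i → Nonempty (P i)
      disjoint : ∀ {i j x} → x ∈ P i → x ∈ P j → i ≡ j
      cover    : ∀ x → ∃[ i ] x ∈ P i

------------------------------------------------------------------------

module _ {c ℓ₁ ℓ₂} (R : Reals c ℓ₁ ℓ₂) where
  open Reals R

  IsMetric : ∀ {n} → (Fin n → Fin n → Carrier) → Set (c ⊔ ℓ₁ ⊔ ℓ₂)
  IsMetric = IsGeneralMetric _≡_ _≈_ _≤ʳ_ 0# _+_

  -- Each edge {x , y} is counted once, as the pair with x < y.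
  weight : ∀ {n} → (Fin n → Fin n → Carrier) → Graph n → Carrier
  weight w G = sum λ x → sum λ y →
    if does (x <? y ×-dec adj? G x y) then w x y else 0#

  IsMST : ∀ {n} → (Fin n → Fin n → Carrier) → Graph n → Set (lsuc 0ℓ ⊔ ℓ₂)
  IsMST w G = IsTreeOn ⊤ G × (∀ H → IsTreeOn ⊤ H → weight w G ≤ʳ weight w H)

  record MFCInput (n t : ℕ) : Set (c ⊔ ℓ₁ ⊔ ℓ₂ ⊔ lsuc 0ℓ) where
    field
      d           : Fin n → Fin n → Carrier
      isMetric    : IsMetric d
      P           : Fin t → Subset n
      isPartition : IsPartition P
      T           : Fin t → Graph n
      isTree      : ∀ i → IsTreeOn (P i) (T i)

    Eₜ : Graph n
    Eₜ = ⋃ T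

    w𝒳 : Graph n → Carrier
    w𝒳 = weight d

    Feasible : Graph n → Set
    Feasible M =
      (∀ {x y} → Adj M x y → ∃₂ λ i j → i ≢ j × x ∈ P i × y ∈ P j) ×
      ConnectedOn ⊤ (Eₜ ∪ M)

    Optimal : Graph n → Set (lsuc 0ℓ ⊔ ℓ₂)
    Optimal M = Feasible M ×
      (∀ M′ → Feasible M′ → w𝒳 M + w𝒳 Eₜ ≤ʳ w𝒳 M′ + w𝒳 Eₜ)

  -- A run of MFC-Approx: all the choices it makes, together with the
  -- properties that the algorithm guarantees for them.
  record MFCApproxRun {n t} (I : MFCInput n t) : Set (c ⊔ ℓ₁ ⊔ ℓ₂ ⊔ lsuc 0ℓ) where
    open MFCInput I
    field
      s   : Fin t → Fin n
      s∈P : ∀ i → s i ∈ P i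

      -- w→ i j is w_{i→j}; only its values at i ≢ j are meaningful, and
      -- likewise for ŵ.
      w→       : Fin t → Fin t → Carrier
      w→-least : ∀ i j → i ≢ j →
                 IsLeast (λ v → ∃[ x ] (x ∈ P i × v ≈ d x (s j))) (w→ i j)
      ŵ        : Fin t → Fin t → Carrier
      ŵ-least  : ∀ i j → i ≢ j →
                 IsLeast (λ v → v ≈ w→ i j ⊎ v ≈ w→ j i) (ŵ i j)

      -- The pair recorded for the components {i , j}, indexed with i < j.
      recorded         : Fin t → Fin t → Fin n × Fin n
      recorded∈P       : ∀ i j → i < j →
                         proj₁ (recorded i j) ∈ P i × proj₂ (recorded i j) ∈ P j
      recorded-attains : ∀ i j → i < j →
                         (proj₁ (recorded i j) ≡ s i ⊎ proj₂ (recorded i j) ≡ s j) ×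
                         d (proj₁ (recorded i j)) (proj₂ (recorded i j)) ≈ ŵ i j

      T̂𝒫       : Graph t
      T̂𝒫-isMST : IsMST ŵ T̂𝒫

    M̂ : Graph n
    M̂ = record
      { Adj    = λ x y → ∃₂ λ i j → i < j × Adj T̂𝒫 i j ×
                   (recorded i j ≡ (x , y) ⊎ recorded i j ≡ (y , x))
      ; adj?   = λ x y → any? λ i → any? λ j → i <? j ×-dec adj? T̂𝒫 i j ×-dec
                   (≡-dec _≟_ _≟_ (recorded i j) (x , y) ⊎-dec
                    ≡-dec _≟_ _≟_ (recorded i j) (y , x))
      ; sym    = λ (i , j , i<j , e , r) → i , j , i<j , e , swap r
      ; irrefl = λ { refl (i , j , i<j , _ , r) → [ no-loop i j i<j , no-loop i j i<j ] r }
      }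
      where
      no-loop : ∀ i j → i < j → ∀ {x} → ¬ (recorded i j ≡ (x , x))
      no-loop i j i<j q = <⇒≢ i<j (IsPartition.disjoint isPartition
        (subst (_∈ P i) (cong proj₁ q) (proj₁ (recorded∈P i j i<j)))
        (subst (_∈ P j) (cong proj₂ q) (proj₂ (recorded∈P i j i<j))))

    T̂ : Graph n
    T̂ = Eₜ ∪ M̂

{-# OPTIONS --safe #-}

-- The factor obtained is 2 ≤ β.  Contract the components and let H be a
-- spanning tree of the resulting graph of crossings in M*, rooted at an
-- arbitrary component.  For a component k with parent p, joined by an edge
-- (x , y) of M* with x ∈ P k and y ∈ P p,
--   ŵ k p ≤ d (s k) y ≤ d (s k) x + d x y.
-- The first summand is at most w(T k), along the path from s k to x in T k,
-- and each component is the child in exactly one edge of H.  Summing up,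
-- w(M̂) ≤ ŵ(T̂𝒫) ≤ ŵ(H) ≤ w(Eₜ) + w(M*), whence w(T̂) ≤ 2 w(T*).

module Submission where

open import Defs
open import Level using (Level; 0ℓ)
open import Algebra.Apartness.Structures using (IsHeytingField)
open import Algebra.Bundles using (CommutativeRing)
import Algebra.Properties.CommutativeSemigroup
import Algebra.Properties.Group
import Algebra.Properties.Monoid.Mult
import Algebra.Properties.Semiring.Mult
open import Data.Bool.Base using (if_then_else_)
open import Data.Fin.Base using (Fin; _<_)
open import Data.Fin.Properties using (_≟_; _<?_; any?; <-cmp; <⇒≢)
import Data.Fin.Properties as Finₚ
open import Data.Fin.Subset using (⊤) renaming (_∈_ to _∈ₛ_)
open import Data.Fin.Subset.Properties using (∈⊤; _∈?_)
open import Data.List.Base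
  using (List; []; _∷_; _∷ʳ_; _++_; map; filter; tabulate; allFin; cartesianProduct)
open import Data.List.Membership.Propositional using (_∈_)
open import Data.List.Membership.Propositional.Properties
  using (∈-∃++; ∈-++⁺ˡ; ∈-++⁺ʳ; ∈-++⁻;
         ∈-filter⁺; ∈-filter⁻; ∈-allFin; ∈-cartesianProduct⁺)
import Data.List.Relation.Unary.All as All
open import Data.List.Relation.Unary.All using (All; _∷_)
open import Data.List.Relation.Unary.AllPairs.Core using ([]; _∷_)
open import Data.List.Relation.Unary.Any using (here; there)
open import Data.List.Relation.Unary.Linked using (Linked; _∷_)
open import Data.List.Relation.Unary.Unique.Propositional using (Unique)
import Data.List.Relation.Unary.Unique.Propositional.Properties as Uniqueₚ
open import Data.Nat.Base as ℕ using (ℕ; zero; suc; z≤n; s≤s; NonZero; nonZero)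
open import Data.Nat.Induction using (<-wellFounded)
import Data.Nat.Properties as ℕₚ
open import Data.Product.Base using (_×_; _,_; proj₁; proj₂; ∃-syntax; ∃₂; uncurry; swap)
open import Data.Sum.Base as Sum using (_⊎_; inj₁; inj₂; [_,_]′)
open import Function.Base using (_∘_; id)
open import Function.Metric.Structures using (IsGeneralMetric)
open import Induction.WellFounded using (Acc; acc)
open import Relation.Binary.Construct.Closure.ReflexiveTransitive as Star using (Star; ε; _◅_; _◅◅_)
open import Relation.Binary.Core using (REL)
open import Relation.Binary.Definitions using (tri<; tri≈; tri>)
open import Relation.Binary.PropositionalEquality as ≡ using (_≡_; _≢_)
import Relation.Binary.Reasoning.Base.Triple as Triple
open import Relation.Binary.Structures using (IsPreorder; IsStrictPartialOrder)
open import Relation.Nullary using (¬_; contradiction; yes; no; does)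
open import Relation.Nullary.Decidable using (_×-dec_; _⊎-dec_; ¬?)
open import Relation.Unary using (Pred; Decidable)

open Graph using (Adj; adj?)

-- Either end of a crossing could be moved to a representative. The child's end is the one to move:
-- a component may have many children but has at most one parent, so its tree is charged at most
-- once, whereas moving the parent's end could charge the same tree once per child.
--
-- Minimality of `T̂𝒫` speaks only about trees, so H must be shown acyclic. Both H and the paths
-- inside the `T k` are therefore given by parent maps along which a rank strictly decreases. The
-- rank yields termination, acyclicity and the distinctness of the edges that are charged.
--
-- Since `x ≤ y` means that `y < x` fails and the order is not decidable, no step may decide between
-- `x ≤ y` and `y ≤ x`. Weights are compared by matching lists of edges injectively, and
-- non-negativity absorbs whatever stays unmatched.

-- Order and arithmetic in an ordered field without trichotomy.

module OrderedFieldProperties {c ℓ₁ ℓ₂} (F : OrderedField c ℓ₁ ℓ₂) where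
  open OrderedField F
  open IsHeytingField isHeytingField using (#-cotrans; invertible⇒#)
  open IsStrictPartialOrder isStrictPartialOrder public
    using (<-resp-≈; <-respˡ-≈; <-respʳ-≈)
    renaming (trans to <-trans; irrefl to <-irrefl; asym to <-asym)
  open CommutativeRing commutativeRing public
    hiding (_≈_; _+_; _*_; -_; 0#; 1#; Carrier; zero; _-_)
  open Algebra.Properties.Group +-group using (\\-leftDividesˡ; \\-leftDividesʳ; ε⁻¹≈ε)
  open Algebra.Properties.CommutativeSemigroup +-commutativeSemigroup public
    using (interchange; x∙yz≈y∙xz)
  open Algebra.Properties.CommutativeSemigroup *-commutativeSemigroup
    using () renaming (interchange to *-interchange)
  open Algebra.Properties.Monoid.Mult +-monoid public using (×-homo-+; ×-homo-1)
  open Algebra.Properties.Semiring.Mult semiring public using (×1-homo-*)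

  private variable x y z u v : Carrier

  -- The substitute for trichotomy: both mixed transitivity laws for `_<ʳ_` and its negation rest on
  -- it. The two alternatives of apartness that point the wrong way are repaired by transitivity.
  <-cotrans : x <ʳ y → ∀ z → x <ʳ z ⊎ z <ʳ y
  <-cotrans x<y z with #-cotrans (inj₁ x<y) z
  ... | inj₁ (inj₁ x<z) = inj₁ x<z
  ... | inj₁ (inj₂ z<x) = inj₂ (<-trans z<x x<y)
  ... | inj₂ (inj₁ z<y) = inj₂ z<y
  ... | inj₂ (inj₂ y<z) = inj₁ (<-trans x<y y<z)

  ≤-reflexive : x ≈ y → x ≤ʳ y
  ≤-reflexive x≈y = <-irrefl (sym x≈y)

  ≤-refl : x ≤ʳ x
  ≤-refl = ≤-reflexive refl

  <⇒≤ : x <ʳ y → x ≤ʳ y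
  <⇒≤ = <-asym

  <-≤-trans : x <ʳ y → y ≤ʳ z → x <ʳ z
  <-≤-trans {z = z} x<y y≤z with <-cotrans x<y z
  ... | inj₁ x<z = x<z
  ... | inj₂ z<y = contradiction z<y y≤z

  ≤-<-trans : x ≤ʳ y → y <ʳ z → x <ʳ z
  ≤-<-trans {x = x} x≤y y<z with <-cotrans y<z x
  ... | inj₁ y<x = contradiction y<x x≤y
  ... | inj₂ x<z = x<z

  ≤-trans : x ≤ʳ y → y ≤ʳ z → x ≤ʳ z
  ≤-trans x≤y y≤z z<x = x≤y (≤-<-trans y≤z z<x)

  ≤-isPreorder : IsPreorder _≈_ _≤ʳ_
  ≤-isPreorder = record
    { isEquivalence = isEquivalence ; reflexive = ≤-reflexive ; trans = ≤-trans }

  module ≤-Reasoning =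
    Triple ≤-isPreorder <-asym <-trans <-resp-≈ <⇒≤ <-≤-trans ≤-<-trans

  open ≤-Reasoning

  +-cancelˡ-< : ∀ z → z + x <ʳ z + y → x <ʳ y
  +-cancelˡ-< {x} {y} z z+x<z+y = begin-strict
    x               ≈⟨ \\-leftDividesʳ z x ⟨
    - z + (z + x)   <⟨ +-monoʳ-< (- z) z+x<z+y ⟩
    - z + (z + y)   ≈⟨ \\-leftDividesʳ z y ⟩
    y               ∎

  +-monoʳ-≤ : ∀ z → x ≤ʳ y → z + x ≤ʳ z + y
  +-monoʳ-≤ z x≤y z+y<z+x = x≤y (+-cancelˡ-< z z+y<z+x)

  +-monoˡ-≤ : ∀ z → x ≤ʳ y → x + z ≤ʳ y + z
  +-monoˡ-≤ {x} {y} z x≤y = begin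
    x + z  ≈⟨ +-comm x z ⟩
    z + x  ≤⟨ +-monoʳ-≤ z x≤y ⟩
    z + y  ≈⟨ +-comm z y ⟩
    y + z  ∎

  +-mono-≤ : x ≤ʳ y → u ≤ʳ v → x + u ≤ʳ y + v
  +-mono-≤ {y = y} {u} x≤y u≤v = ≤-trans (+-monoˡ-≤ u x≤y) (+-monoʳ-≤ y u≤v)

  +-nonneg : 0# ≤ʳ x → 0# ≤ʳ y → 0# ≤ʳ x + y
  +-nonneg 0≤x 0≤y = ≤-trans (≤-reflexive (sym (+-identityˡ 0#))) (+-mono-≤ 0≤x 0≤y)

  <⇒0<-+ : x <ʳ y → 0# <ʳ - x + y
  <⇒0<-+ {x} x<y = <-respˡ-≈ (-‿inverseˡ x) (+-monoʳ-< (- x) x<y)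

  -0-identityʳ : ∀ x → x + - 0# ≈ x
  -0-identityʳ x = trans (+-congˡ ε⁻¹≈ε) (+-identityʳ x)

  *-monoˡ-<-pos : 0# <ʳ z → x <ʳ y → z * x <ʳ z * y
  *-monoˡ-<-pos {z} {x} {y} 0<z x<y = begin-strict
    z * x                      ≈⟨ +-identityʳ _ ⟨
    z * x + 0#                 <⟨ +-monoʳ-< (z * x) (*-positive 0<z (<⇒0<-+ x<y)) ⟩
    z * x + z * (- x + y)      ≈⟨ distribˡ z x (- x + y) ⟨
    z * (x + (- x + y))        ≈⟨ *-congˡ (\\-leftDividesˡ x y) ⟩
    z * y                      ∎

  -- The sign of `y` cannot be decided outright, but an invertible element is apart from zero, which
  -- leaves `y < 0` or `0 < y`; the former would give `1 < 0`.
  positive⇒inverse-positive : 0# <ʳ x → ∃[ y ] 0# <ʳ y × y * x ≈ 1#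
  positive⇒inverse-positive {x} 0<x with y , inv , _ ← #⇒invertible (inj₂ 0<x) = y , 0<y , yx≈1
    where
    yx≈1 : y * x ≈ 1#
    yx≈1 = trans (*-congˡ (sym (-0-identityʳ x))) inv

    y-invertible : (y + - 0#) * x ≈ 1#
    y-invertible = trans (*-congʳ (-0-identityʳ y)) yx≈1

    0<y : 0# <ʳ y
    0<y with invertible⇒# (x , trans (*-comm _ _) y-invertible , y-invertible)
    ... | inj₂ 0<y = 0<y
    ... | inj₁ y<0 = contradiction 0<1 (<⇒≤ (begin-strict
      1#      ≈⟨ yx≈1 ⟨
      y * x   ≈⟨ *-comm y x ⟩
      x * y   <⟨ *-monoˡ-<-pos 0<x y<0 ⟩
      x * 0#  ≈⟨ zeroʳ x ⟩
      0#      ∎))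

  *-cancelˡ-<-pos : 0# <ʳ x → x * u <ʳ x * v → u <ʳ v
  *-cancelˡ-<-pos {x} {u} {v} 0<x xu<xv with y , 0<y , yx≈1 ← positive⇒inverse-positive 0<x =
    begin-strict
      u            ≈⟨ undo u ⟨
      y * (x * u)  <⟨ *-monoˡ-<-pos 0<y xu<xv ⟩
      y * (x * v)  ≈⟨ undo v ⟩
      v            ∎
    where
    undo : ∀ w → y * (x * w) ≈ w
    undo w = begin-equality
      y * (x * w)  ≈⟨ *-assoc y x w ⟨
      y * x * w    ≈⟨ *-congʳ yx≈1 ⟩
      1# * w       ≈⟨ *-identityˡ w ⟩
      w            ∎

  -- Strictness makes `- x + y` a positive factor, so it could be cancelled from a negative product,
  -- leaving `z < 0`.
  *-monoʳ-≤-nonneg : 0# ≤ʳ z → x <ʳ y → x * z ≤ʳ y * z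
  *-monoʳ-≤-nonneg {z} {x} {y} 0≤z x<y = begin
    x * z                   ≈⟨ +-identityʳ _ ⟨
    x * z + 0#              ≤⟨ +-monoʳ-≤ (x * z) 0≤[y-x]z ⟩
    x * z + (- x + y) * z   ≈⟨ distribʳ z x (- x + y) ⟨
    (x + (- x + y)) * z     ≈⟨ *-congʳ (\\-leftDividesˡ x y) ⟩
    y * z                   ∎
    where
    0≤[y-x]z : 0# ≤ʳ (- x + y) * z
    0≤[y-x]z p = 0≤z (*-cancelˡ-<-pos (<⇒0<-+ x<y) (<-respʳ-≈ (sym (zeroʳ _)) p))

  -- The factorisation of `y² - x²`, read as a comparison of `(y + x) * x` with `(y + x) * y`.
  square-cancel-< : 0# <ʳ y + x → x * x <ʳ y * y → x <ʳ y
  square-cancel-< {y} {x} 0<y+x x²<y² = *-cancelˡ-<-pos 0<y+x (begin-strict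
    (y + x) * x    ≈⟨ distribʳ x y x ⟩
    y * x + x * x  <⟨ +-monoʳ-< (y * x) x²<y² ⟩
    y * x + y * y  ≈⟨ +-comm _ _ ⟩
    y * y + y * x  ≈⟨ +-congˡ (*-comm y x) ⟩
    y * y + x * y  ≈⟨ distribʳ y y x ⟨
    (y + x) * y    ∎)

  fromℕ-+ : ∀ m n → fromℕ (m ℕ.+ n) ≈ fromℕ m + fromℕ n
  fromℕ-+ = ×-homo-+ 1#

  fromℕ-* : ∀ m n → fromℕ (m ℕ.* n) ≈ fromℕ m * fromℕ n
  fromℕ-* = ×1-homo-*

  2*-double : ∀ x → fromℕ 2 * x ≈ x + x
  2*-double x = begin-equality
    fromℕ 2 * x              ≈⟨ *-congʳ (fromℕ-+ 1 1) ⟩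
    (fromℕ 1 + fromℕ 1) * x  ≈⟨ *-congʳ (+-cong (×-homo-1 1#) (×-homo-1 1#)) ⟩
    (1# + 1#) * x            ≈⟨ distribʳ x 1# 1# ⟩
    1# * x + 1# * x          ≈⟨ +-cong (*-identityˡ x) (*-identityˡ x) ⟩
    x + x                    ∎

  fromℕ-<-+ : ∀ m k .{{_ : NonZero k}} → fromℕ m <ʳ fromℕ (m ℕ.+ k)
  fromℕ-<-+ m k = begin-strict
    fromℕ m            ≈⟨ +-identityʳ _ ⟨
    fromℕ m + 0#       <⟨ +-monoʳ-< (fromℕ m) (fromℕ-positive k) ⟩
    fromℕ m + fromℕ k  ≈⟨ fromℕ-+ m k ⟨
    fromℕ (m ℕ.+ k)    ∎

  *-/-cancel : ∀ n .{{_ : NonZero n}} x → fromℕ n * (x / n) ≈ x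
  *-/-cancel n x with i , inv , _ ← fromℕ-invertible n = begin-equality
    fromℕ n * (x * i)           ≈⟨ *-comm _ _ ⟩
    x * i * fromℕ n             ≈⟨ *-assoc x i _ ⟩
    x * (i * fromℕ n)           ≈⟨ *-congˡ (*-congˡ (-0-identityʳ _)) ⟨
    x * (i * (fromℕ n + - 0#))  ≈⟨ *-congˡ inv ⟩
    x * 1#                      ≈⟨ *-identityʳ x ⟩
    x                           ∎

  -- Numerical bounds on β.

  module _ {r : Carrier} (r-isSqrt : IsSqrt (fromℕ 5) r) where
    private
      r² : r * r ≈ fromℕ 5
      r² = proj₂ r-isSqrt

      0≤r : 0# ≤ʳ r
      0≤r = proj₁ r-isSqrt

      β : Carrier
      β = (fromℕ 3 + r) / 2

    1<√5 : fromℕ 1 <ʳ r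
    1<√5 = square-cancel-< (<-≤-trans (fromℕ-positive 1) 1≤r+1) (begin-strict
      fromℕ 1 * fromℕ 1  ≈⟨ fromℕ-* 1 1 ⟨
      fromℕ 1            <⟨ fromℕ-<-+ 1 4 ⟩
      fromℕ 5            ≈⟨ r² ⟨
      r * r              ∎)
      where
      1≤r+1 : fromℕ 1 ≤ʳ r + fromℕ 1
      1≤r+1 = ≤-trans (≤-reflexive (sym (+-identityˡ _))) (+-monoˡ-≤ (fromℕ 1) 0≤r)

    -- 56 / 25 = 2 · 2.62 - 3, the bound on √5 that β < 2.62 amounts to.
    25√5<56 : fromℕ 25 * r <ʳ fromℕ 56
    25√5<56 = square-cancel-< 0<56+25r (begin-strict
      fromℕ 25 * r * (fromℕ 25 * r)    ≈⟨ *-interchange _ _ _ _ ⟩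
      fromℕ 25 * fromℕ 25 * (r * r)    ≈⟨ *-cong (fromℕ-* 25 25) (sym r²) ⟨
      fromℕ 625 * fromℕ 5              ≈⟨ fromℕ-* 625 5 ⟨
      fromℕ 3125                       <⟨ fromℕ-<-+ 3125 11 ⟩
      fromℕ 3136                       ≈⟨ fromℕ-* 56 56 ⟩
      fromℕ 56 * fromℕ 56              ∎)
      where
      0<56+25r : 0# <ʳ fromℕ 56 + fromℕ 25 * r
      0<56+25r = begin-strict
        0#                        <⟨ fromℕ-positive 56 ⟩
        fromℕ 56                  ≈⟨ +-identityʳ _ ⟨
        fromℕ 56 + 0#             ≈⟨ +-congˡ (zeroˡ r) ⟨
        fromℕ 56 + 0# * r         ≤⟨ +-monoʳ-≤ _ (*-monoʳ-≤-nonneg 0≤r (fromℕ-positive 25)) ⟩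
        fromℕ 56 + fromℕ 25 * r   ∎

    2<[3+√5]/2 : fromℕ 2 <ʳ β
    2<[3+√5]/2 = *-cancelˡ-<-pos (fromℕ-positive 2) (begin-strict
      fromℕ 2 * fromℕ 2  ≈⟨ fromℕ-* 2 2 ⟨
      fromℕ 4            ≈⟨ fromℕ-+ 3 1 ⟩
      fromℕ 3 + fromℕ 1  <⟨ +-monoʳ-< (fromℕ 3) 1<√5 ⟩
      fromℕ 3 + r        ≈⟨ *-/-cancel 2 (fromℕ 3 + r) ⟨
      fromℕ 2 * β        ∎)

    [3+√5]/2<2·62 : β <ʳ fromℕ 262 / 100
    [3+√5]/2<2·62 = *-cancelˡ-<-pos (fromℕ-positive 100) (begin-strict
      fromℕ 100 * β                             ≈⟨ *-congʳ (fromℕ-* 50 2) ⟩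
      fromℕ 50 * fromℕ 2 * β                    ≈⟨ *-assoc _ _ _ ⟩
      fromℕ 50 * (fromℕ 2 * β)                  ≈⟨ *-congˡ (*-/-cancel 2 (fromℕ 3 + r)) ⟩
      fromℕ 50 * (fromℕ 3 + r)                  ≈⟨ distribˡ _ _ _ ⟩
      fromℕ 50 * fromℕ 3 + fromℕ 50 * r         ≈⟨ +-cong (sym (fromℕ-* 50 3)) (*-congʳ (fromℕ-* 2 25)) ⟩
      fromℕ 150 + fromℕ 2 * fromℕ 25 * r        ≈⟨ +-congˡ (*-assoc _ _ _) ⟩
      fromℕ 150 + fromℕ 2 * (fromℕ 25 * r)      <⟨ +-monoʳ-< _ (*-monoˡ-<-pos (fromℕ-positive 2) 25√5<56) ⟩
      fromℕ 150 + fromℕ 2 * fromℕ 56            ≈⟨ +-congˡ (fromℕ-* 2 56) ⟨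
      fromℕ 150 + fromℕ 112                     ≈⟨ fromℕ-+ 150 112 ⟨
      fromℕ 262                                 ≈⟨ *-/-cancel 100 (fromℕ 262) ⟨
      fromℕ 100 * (fromℕ 262 / 100)             ∎)

-- Finite sums over lists and their comparison.

module ListSums {c ℓ₁ ℓ₂} (F : OrderedField c ℓ₁ ℓ₂) where
  open OrderedField F
  open OrderedFieldProperties F
  open ≤-Reasoning

  private variable
    a p : Level
    A B : Set a

  ∑ : List A → (A → Carrier) → Carrier
  ∑ []       f = 0#
  ∑ (x ∷ xs) f = f x + ∑ xs f

  ∑-mono-≤ : ∀ (xs : List A) {f g} → (∀ {x} → x ∈ xs → f x ≤ʳ g x) → ∑ xs f ≤ʳ ∑ xs g
  ∑-mono-≤ []       f≤g = ≤-refl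
  ∑-mono-≤ (x ∷ xs) f≤g = +-mono-≤ (f≤g (here ≡.refl)) (∑-mono-≤ xs (f≤g ∘ there))

  ∑-cong : ∀ (xs : List A) {f g} → (∀ x → f x ≈ g x) → ∑ xs f ≈ ∑ xs g
  ∑-cong []       f≈g = refl
  ∑-cong (x ∷ xs) f≈g = +-cong (f≈g x) (∑-cong xs f≈g)

  ∑-nonneg : ∀ (xs : List A) {f} → (∀ {x} → x ∈ xs → 0# ≤ʳ f x) → 0# ≤ʳ ∑ xs f
  ∑-nonneg []       0≤f = ≤-refl
  ∑-nonneg (x ∷ xs) 0≤f = +-nonneg (0≤f (here ≡.refl)) (∑-nonneg xs (0≤f ∘ there))

  ∑-+ : ∀ (xs : List A) f g → ∑ xs (λ x → f x + g x) ≈ ∑ xs f + ∑ xs g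
  ∑-+ []       f g = sym (+-identityˡ 0#)
  ∑-+ (x ∷ xs) f g = trans (+-congˡ (∑-+ xs f g)) (interchange (f x) (g x) (∑ xs f) (∑ xs g))

  ∑-++ : ∀ (xs ys : List A) f → ∑ (xs ++ ys) f ≈ ∑ xs f + ∑ ys f
  ∑-++ []       ys f = sym (+-identityˡ _)
  ∑-++ (x ∷ xs) ys f = trans (+-congˡ (∑-++ xs ys f)) (sym (+-assoc (f x) (∑ xs f) (∑ ys f)))

  ∑-map : ∀ (h : A → B) xs f → ∑ (map h xs) f ≈ ∑ xs (f ∘ h)
  ∑-map h []       f = refl
  ∑-map h (x ∷ xs) f = +-congˡ (∑-map h xs f)

  ∑-filter : ∀ {P : Pred A p} (P? : Decidable P) xs f →
             ∑ (filter P? xs) f ≈ ∑ xs (λ x → if does (P? x) then f x else 0#)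
  ∑-filter P? []       f = refl
  ∑-filter P? (x ∷ xs) f with P? x
  ... | yes _ = +-congˡ (∑-filter P? xs f)
  ... | no  _ = trans (∑-filter P? xs f) (sym (+-identityˡ _))

  ∑-cartesianProduct : ∀ (xs : List A) (ys : List B) f →
    ∑ (cartesianProduct xs ys) f ≈ ∑ xs λ x → ∑ ys λ y → f (x , y)
  ∑-cartesianProduct []       ys f = refl
  ∑-cartesianProduct (x ∷ xs) ys f = trans (∑-++ (map (x ,_) ys) _ f)
    (+-cong (∑-map (x ,_) ys f) (∑-cartesianProduct xs ys f))

  ∑-filter-cartesianProduct : ∀ {P : Pred (A × B) p} (P? : Decidable P) xs ys f →
    ∑ (filter P? (cartesianProduct xs ys)) f ≈
    ∑ xs λ x → ∑ (filter (λ y → P? (x , y)) ys) λ y → f (x , y)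
  ∑-filter-cartesianProduct P? xs ys f = trans (∑-filter P? (cartesianProduct xs ys) f)
    (trans (∑-cartesianProduct xs ys _)
      (∑-cong xs λ x → sym (∑-filter (λ y → P? (x , y)) ys (λ y → f (x , y)))))

  sum≈∑-tabulate : ∀ {n} (h : Fin n → A) f → sum (f ∘ h) ≈ ∑ (tabulate h) f
  sum≈∑-tabulate {n = zero}  h f = refl
  sum≈∑-tabulate {n = suc n} h f = +-congˡ (sum≈∑-tabulate (h ∘ Fin.suc) f)

  -- Each step removes from `ys` the partner of the head of `xs`; what remains of `ys` at the end is
  -- non-negative. The matching is a relation because edges will be matched only up to orientation.
  ∑-injection-≤ : ∀ {xs : List A} {ys : List B} {f g} (_∼_ : REL A B p) →
    Unique xs →
    (∀ {y} → y ∈ ys → 0# ≤ʳ g y) →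
    (∀ {x} → x ∈ xs → ∃[ y ] y ∈ ys × x ∼ y × f x ≤ʳ g y) →
    (∀ {x x′ y} → x ∈ xs → x′ ∈ xs → x ∼ y → x′ ∼ y → x ≡ x′) →
    ∑ xs f ≤ʳ ∑ ys g
  ∑-injection-≤ {xs = []} {ys} _∼_ _ 0≤g _ _ = ∑-nonneg ys 0≤g
  ∑-injection-≤ {xs = x ∷ xs} {f = f} {g} _∼_ (x∉xs ∷ xs!) 0≤g image inj
    with y , y∈ys , x∼y , fx≤gy ← image (here ≡.refl)
    with ys₁ , ys₂ , ≡.refl ← ∈-∃++ y∈ys = begin
      f x + ∑ xs f                  ≤⟨ +-mono-≤ fx≤gy rest ⟩
      g y + ∑ (ys₁ ++ ys₂) g        ≈⟨ +-congˡ (∑-++ ys₁ ys₂ g) ⟩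
      g y + (∑ ys₁ g + ∑ ys₂ g)     ≈⟨ x∙yz≈y∙xz (g y) (∑ ys₁ g) (∑ ys₂ g) ⟩
      ∑ ys₁ g + (g y + ∑ ys₂ g)     ≈⟨ ∑-++ ys₁ (y ∷ ys₂) g ⟨
      ∑ (ys₁ ++ y ∷ ys₂) g          ∎
    where
    widen : ∀ {z} → z ∈ ys₁ ++ ys₂ → z ∈ ys₁ ++ y ∷ ys₂
    widen z∈ = [ ∈-++⁺ˡ , ∈-++⁺ʳ ys₁ ∘ there ]′ (∈-++⁻ ys₁ z∈)

    narrow : ∀ {z} → z ≢ y → z ∈ ys₁ ++ y ∷ ys₂ → z ∈ ys₁ ++ ys₂
    narrow z≢y z∈ with ∈-++⁻ ys₁ z∈
    ... | inj₁ z∈ys₁         = ∈-++⁺ˡ z∈ys₁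
    ... | inj₂ (here z≡y)    = contradiction z≡y z≢y
    ... | inj₂ (there z∈ys₂) = ∈-++⁺ʳ ys₁ z∈ys₂

    image′ : ∀ {x′} → x′ ∈ xs → ∃[ z ] z ∈ ys₁ ++ ys₂ × x′ ∼ z × f x′ ≤ʳ g z
    image′ x′∈xs with z , z∈ , x′∼z , le ← image (there x′∈xs) =
      -- The removed `y` cannot be the partner of a later `x′`: injectivity would give `x ≡ x′`,
      -- against `Unique`.
      z , narrow (λ { ≡.refl → All.lookup x∉xs x′∈xs (inj (here ≡.refl) (there x′∈xs) x∼y x′∼z) }) z∈ ,
      x′∼z , le

    rest : ∑ xs f ≤ʳ ∑ (ys₁ ++ ys₂) g
    rest = ∑-injection-≤ _∼_ xs! (0≤g ∘ widen) image′ (λ x∈ x′∈ → inj (there x∈) (there x′∈))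

-- Undirected edges and the weight of a graph.

module _ {n : ℕ} where
  infix 4 _≐_
  -- A weight counts an edge at its increasing pair, whereas parent links and recorded pairs may
  -- come in either orientation.
  _≐_ : Fin n × Fin n → Fin n × Fin n → Set
  e ≐ e′ = e ≡ e′ ⊎ e ≡ swap e′

  ≐-sym : ∀ {e e′} → e ≐ e′ → e′ ≐ e
  ≐-sym (inj₁ ≡.refl) = inj₁ ≡.refl
  ≐-sym (inj₂ ≡.refl) = inj₂ ≡.refl

  ≐-trans : ∀ {e₁ e₂ e₃} → e₁ ≐ e₂ → e₂ ≐ e₃ → e₁ ≐ e₃
  ≐-trans (inj₁ ≡.refl) q             = q
  ≐-trans (inj₂ ≡.refl) (inj₁ ≡.refl) = inj₂ ≡.refl
  ≐-trans (inj₂ ≡.refl) (inj₂ ≡.refl) = inj₁ ≡.refl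

  ≐-ordered : ∀ {x y x′ y′ : Fin n} → x < y → x′ < y′ → (x , y) ≐ (x′ , y′) → (x , y) ≡ (x′ , y′)
  ≐-ordered x<y x′<y′ (inj₁ eq)      = eq
  ≐-ordered x<y x′<y′ (inj₂ ≡.refl) = contradiction x<y (Finₚ.<-asym x′<y′)

  module _ (G : Graph n) where
    edge? : Decidable (λ ((x , y) : Fin n × Fin n) → x < y × Adj G x y)
    edge? (x , y) = x <? y ×-dec adj? G x y

    edges : List (Fin n × Fin n)
    edges = filter edge? (cartesianProduct (allFin n) (allFin n))

    edges-unique : Unique edges
    edges-unique = Uniqueₚ.filter⁺ edge?
      (Uniqueₚ.cartesianProduct⁺ (Uniqueₚ.allFin⁺ n) (Uniqueₚ.allFin⁺ n))

    ∈-edges⁺ : ∀ {x y} → x < y → Adj G x y → (x , y) ∈ edges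
    ∈-edges⁺ {x} {y} x<y xy = ∈-filter⁺ edge? (∈-cartesianProduct⁺ (∈-allFin x) (∈-allFin y)) (x<y , xy)

    ∈-edges⁻ : ∀ {x y} → (x , y) ∈ edges → x < y × Adj G x y
    ∈-edges⁻ = proj₂ ∘ ∈-filter⁻ edge? {xs = cartesianProduct (allFin n) (allFin n)}

    edge-orientation : ∀ {x y} → Adj G x y → ∃[ e ] e ∈ edges × (x , y) ≐ e
    edge-orientation {x} {y} xy with <-cmp x y
    ... | tri< x<y _ _    = (x , y) , ∈-edges⁺ x<y xy , inj₁ ≡.refl
    ... | tri≈ _ x≡y _    = contradiction xy (Graph.irrefl G x≡y)
    ... | tri> _ _ y<x    = (y , x) , ∈-edges⁺ y<x (Graph.sym G xy) , inj₂ ≡.refl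

module GraphWeight {c ℓ₁ ℓ₂} (R : Reals c ℓ₁ ℓ₂) {n : ℕ} (w : Fin n → Fin n → Reals.Carrier R) where
  open Reals R
  open OrderedFieldProperties orderedField
  open ListSums orderedField
  open ≤-Reasoning

  private variable
    a : Level
    A : Set a
    G : Graph n

  weight≈∑ : ∀ G → weight R w G ≈ ∑ (edges G) (uncurry w)
  weight≈∑ G = sym (begin-equality
    ∑ (edges G) (uncurry w)
      ≈⟨ ∑-filter (edge? G) (cartesianProduct (allFin n) (allFin n)) (uncurry w) ⟩
    ∑ (cartesianProduct (allFin n) (allFin n)) (λ (x , y) → entry x y)
      ≈⟨ ∑-cartesianProduct (allFin n) (allFin n) (λ (x , y) → entry x y) ⟩
    ∑ (allFin n) (λ x → ∑ (allFin n) (entry x))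
      ≈⟨ ∑-cong (allFin n) (λ x → sum≈∑-tabulate id (entry x)) ⟨
    ∑ (allFin n) (λ x → sum (entry x))
      ≈⟨ sum≈∑-tabulate id (λ x → sum (entry x)) ⟨
    weight R w G ∎)
    where
    entry : Fin n → Fin n → Carrier
    entry x y = if does (edge? G (x , y)) then w x y else 0#

  -- Edges covered by the same index agree up to orientation, and increasing pairs that do so are
  -- equal. This precedes the assumptions of symmetry and non-negativity because it is also applied
  -- to `ŵ`, whose diagonal is unconstrained.
  weight-≤-∑ : ∀ {xs : List A} {f} (e : A → Fin n × Fin n) →
    (∀ {a} → a ∈ xs → 0# ≤ʳ f a) →
    (∀ {x y} → x < y → Adj G x y → ∃[ a ] a ∈ xs × e a ≐ (x , y) × w x y ≤ʳ f a) →
    weight R w G ≤ʳ ∑ xs f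
  weight-≤-∑ {G = G} {xs = xs} {f} e 0≤f covered = begin
    weight R w G              ≈⟨ weight≈∑ G ⟩
    ∑ (edges G) (uncurry w)   ≤⟨ ∑-injection-≤ (λ xy a → e a ≐ xy) (edges-unique G) 0≤f
                                   (uncurry covered ∘ ∈-edges⁻ G) same ⟩
    ∑ xs f                    ∎
    where
    same : ∀ {xy xy′ a} → xy ∈ edges G → xy′ ∈ edges G → e a ≐ xy → e a ≐ xy′ → xy ≡ xy′
    same xy∈ xy′∈ p q =
      ≐-ordered (proj₁ (∈-edges⁻ G xy∈)) (proj₁ (∈-edges⁻ G xy′∈)) (≐-trans (≐-sym p) q)

  module _ (w-sym : ∀ x y → w x y ≈ w y x) (w-nonneg : ∀ x y → 0# ≤ʳ w x y) where

    -- Symmetry turns the listed edges into increasing pairs; by non-negativity, the edges of `G`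
    -- that are not listed can only add weight.
    ∑-≤-weight : ∀ {xs : List A} (e : A → Fin n × Fin n) → Unique xs →
      (∀ {a} → a ∈ xs → uncurry (Adj G) (e a)) →
      (∀ {a b} → a ∈ xs → b ∈ xs → e a ≐ e b → a ≡ b) →
      ∑ xs (uncurry w ∘ e) ≤ʳ weight R w G
    ∑-≤-weight {G = G} {xs = xs} e xs! e∈G e-inj = begin
      ∑ xs (uncurry w ∘ e)      ≤⟨ ∑-injection-≤ (λ a xy → e a ≐ xy) xs! (λ _ → w-nonneg _ _) image
                                     (λ a∈ b∈ p q → e-inj a∈ b∈ (≐-trans p (≐-sym q))) ⟩
      ∑ (edges G) (uncurry w)   ≈⟨ weight≈∑ G ⟨
      weight R w G              ∎
      where
      w-≐ : ∀ {xy xy′} → xy ≐ xy′ → uncurry w xy ≈ uncurry w xy′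
      w-≐ (inj₁ ≡.refl) = refl
      w-≐ (inj₂ ≡.refl) = w-sym _ _

      image : ∀ {a} → a ∈ xs → ∃[ xy ] xy ∈ edges G × e a ≐ xy × uncurry w (e a) ≤ʳ uncurry w xy
      image a∈ with xy , xy∈ , p ← edge-orientation G (e∈G a∈) = xy , xy∈ , p , ≤-reflexive (w-≐ p)

    weight-nonneg : ∀ G → 0# ≤ʳ weight R w G
    weight-nonneg G = ≤-trans
      (∑-nonneg (edges G) (λ _ → w-nonneg _ _))
      (≤-reflexive (sym (weight≈∑ G)))

    private
      ∑-edges-++ : ∀ G H → ∑ (edges G ++ edges H) (uncurry w) ≈ weight R w G + weight R w H
      ∑-edges-++ G H = trans (∑-++ (edges G) (edges H) (uncurry w))
        (+-cong (sym (weight≈∑ G)) (sym (weight≈∑ H)))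

    weight-∪-≤ : ∀ G H → weight R w (G ∪ H) ≤ʳ weight R w G + weight R w H
    weight-∪-≤ G H = ≤-trans
      (weight-≤-∑ {G = G ∪ H} {xs = edges G ++ edges H} id (λ _ → w-nonneg _ _) λ where
        x<y (inj₁ xy) → _ , ∈-++⁺ˡ (∈-edges⁺ G x<y xy) , inj₁ ≡.refl , ≤-refl
        x<y (inj₂ xy) → _ , ∈-++⁺ʳ (edges G) (∈-edges⁺ H x<y xy) , inj₁ ≡.refl , ≤-refl)
      (≤-reflexive (∑-edges-++ G H))

    weight-∪-disjoint : ∀ G H → (∀ {x y} → Adj G x y → ¬ Adj H x y) →
      weight R w G + weight R w H ≤ʳ weight R w (G ∪ H)
    weight-∪-disjoint G H disj = ≤-trans (≤-reflexive (sym (∑-edges-++ G H)))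
      (∑-≤-weight {G = G ∪ H} id
        (Uniqueₚ.++⁺ (edges-unique G) (edges-unique H)
          (λ (p , q) → disj (proj₂ (∈-edges⁻ G p)) (proj₂ (∈-edges⁻ H q))))
        (proj₂ ∘ edge∈)
        (λ p q → ≐-ordered (proj₁ (edge∈ p)) (proj₁ (edge∈ q))))
      where
      edge∈ : ∀ {x y} → (x , y) ∈ edges G ++ edges H → x < y × Adj (G ∪ H) x y
      edge∈ p with ∈-++⁻ (edges G) p
      ... | inj₁ q = proj₁ (∈-edges⁻ G q) , inj₁ (proj₂ (∈-edges⁻ G q))
      ... | inj₂ q = proj₁ (∈-edges⁻ H q) , inj₂ (proj₂ (∈-edges⁻ H q))

-- Breadth-first forests.

least : ∀ {p} {P : Pred ℕ p} → Decidable P → ∀ n → P n →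
        ∃[ m ] P m × (∀ {k} → P k → m ℕ.≤ k)
least P? n Pn with P? 0
... | yes P0 = 0 , P0 , λ _ → z≤n
least P? zero    P0 | no ¬P0 = contradiction P0 ¬P0
least P? (suc n) Pn | no ¬P0 with m , Pm , min ← least (P? ∘ suc) n Pn =
  suc m , Pm , λ { {zero} P0 → contradiction P0 ¬P0 ; {suc k} Pk → s≤s (min Pk) }

record SpanningForest {n} (G : Graph n) (Root : Pred (Fin n) 0ℓ) : Set where
  field
    parent     : Fin n → Fin n
    rank       : Fin n → ℕ
    parent-adj : ∀ {x} → ¬ Root x → Adj G x (parent x)
    rank-<     : ∀ {x} → ¬ Root x → rank (parent x) ℕ.< rank x

module _ {n} (G : Graph n) {Root : Pred (Fin n) 0ℓ} (Root? : Decidable Root) where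
  private
    -- Walks of exactly `k` steps from a root. Fixing the length makes reachability decidable, which
    -- `least` requires to find the distance.
    Reach : ℕ → Pred (Fin n) 0ℓ
    Reach zero    y = Root y
    Reach (suc k) y = ∃[ x ] Reach k x × Adj G x y

    reach? : ∀ k → Decidable (Reach k)
    reach? zero    y = Root? y
    reach? (suc k) y = any? λ x → reach? k x ×-dec adj? G x y

    reach-star : ∀ k {x y} → Reach k x → Star (Adj G) x y → ∃[ m ] Reach m y
    reach-star k x-reached ε          = k , x-reached
    reach-star k x-reached (xz ◅ zy) = reach-star (suc k) (_ , x-reached , xz) zy

  -- The breadth-first forest: the rank of a node is its distance to the roots.
  abstract
    spanningForest : (∀ x → ∃[ r ] Root r × Star (Adj G) r x) → SpanningForest G Root
    spanningForest reachable = record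
      { parent     = proj₁ ∘ step
      ; rank       = rank
      ; parent-adj = λ {x} ¬root → proj₁ (proj₂ (step x) ¬root)
      ; rank-<     = λ {x} ¬root → proj₂ (proj₂ (step x) ¬root)
      }
      where
      shortest : ∀ x → ∃[ m ] Reach m x × (∀ {k} → Reach k x → m ℕ.≤ k)
      shortest x with r , root , r⟶x ← reachable x =
        uncurry (least (λ k → reach? k x)) (reach-star 0 root r⟶x)

      rank : Fin n → ℕ
      rank = proj₁ ∘ shortest

      step : ∀ x → ∃[ y ] (¬ Root x → Adj G x y × rank y ℕ.< rank x)
      step x with shortest x
      ... | zero  , root , _          = x , λ ¬root → contradiction root ¬root
      -- The last node before `x` on a shortest walk is reached in `m` steps, so its own least
      -- length is at most `m`.
      ... | suc m , (y , my , yx) , _ = y , λ _ → Graph.sym G yx , s≤s (proj₂ (proj₂ (shortest y)) my)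

-- Trees from parent maps.

module ParentGraph {n} {Root : Pred (Fin n) 0ℓ} (Root? : Decidable Root)
  (parent : Fin n → Fin n) (rank : Fin n → ℕ)
  (rank-< : ∀ {x} → ¬ Root x → rank (parent x) ℕ.< rank x) where

  private
    Up : Fin n → Fin n → Set
    Up x y = ¬ Root x × parent x ≡ y

    up-rank : ∀ {x y} → Up x y → rank y ℕ.< rank x
    up-rank (¬root , ≡.refl) = rank-< ¬root

    up-unique : ∀ {x y z} → Up x y → Up x z → y ≡ z
    up-unique (_ , ≡.refl) (_ , ≡.refl) = ≡.refl

  parentGraph : Graph n
  parentGraph = record
    { Adj    = λ x y → Up x y ⊎ Up y x
    ; adj?   = λ x y → up? x y ⊎-dec up? y x
    ; sym    = Sum.swap
    ; irrefl = λ { ≡.refl e → ℕₚ.<-irrefl ≡.refl ([ up-rank , up-rank ]′ e) }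
    }
    where
    up? : ∀ x y → _
    up? x y = ¬? (Root? x) ×-dec (parent x ≟ y)

  private
    -- Since each node has a single parent, a walk that never turns back
    -- cannot climb again once it has descended.
    descend : ∀ {v w z} ws → Up w v → Linked (Adj parentGraph) (w ∷ ws ∷ʳ z) →
      Unique (v ∷ w ∷ ws) → All (z ≢_) (v ∷ w ∷ ws) →
      rank w ℕ.< rank z × ∃[ y ] y ∈ w ∷ ws × Up z y
    descend []       w↑v (inj₁ w↑z ∷ _) _ (z≢v ∷ _) = contradiction (up-unique w↑z w↑v) z≢v
    descend []       w↑v (inj₂ z↑w ∷ _) _ _ = up-rank z↑w , _ , here ≡.refl , z↑w
    descend (u ∷ us) w↑v (inj₁ w↑u ∷ _) ((_ ∷ v≢u ∷ _) ∷ _) _ = contradiction (up-unique w↑v w↑u) v≢u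
    descend (u ∷ us) w↑v (inj₂ u↑w ∷ walk) (_ ∷ distinct) (_ ∷ z≢)
      with u<z , y , y∈ , z↑y ← descend us u↑w walk distinct z≢ =
      ℕₚ.<-trans (up-rank u↑w) u<z , y , there y∈ , z↑y

    -- Either the walk climbs throughout and ends nearer to the root than `v`, or it turns downwards
    -- once and then enters `z` from the parent of `z`.
    climb : ∀ {v w z} ws → Linked (Adj parentGraph) (v ∷ w ∷ ws ∷ʳ z) →
      Unique (v ∷ w ∷ ws) → All (z ≢_) (v ∷ w ∷ ws) →
      rank z ℕ.< rank v ⊎ ∃[ y ] y ∈ w ∷ ws × Up z y
    climb ws       (inj₂ w↑v ∷ walk) distinct z≢ = inj₂ (proj₂ (descend ws w↑v walk distinct z≢))
    climb []       (inj₁ v↑w ∷ inj₁ w↑z ∷ _) _ _ = inj₁ (ℕₚ.<-trans (up-rank w↑z) (up-rank v↑w))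
    climb []       (inj₁ v↑w ∷ inj₂ z↑w ∷ _) _ _ = inj₂ (_ , here ≡.refl , z↑w)
    climb (u ∷ us) (inj₁ v↑w ∷ walk) (_ ∷ distinct) (_ ∷ z≢) with climb us walk distinct z≢
    ... | inj₁ z<w             = inj₁ (ℕₚ.<-trans z<w (up-rank v↑w))
    ... | inj₂ (y , y∈ , z↑y) = inj₂ (y , there y∈ , z↑y)

  -- The cases are the directions of the first edges. Starting up to `v`, `climb` contradicts either
  -- the rank or the fact that `v` is the only parent of `x`. Down and then up gives `v` two
  -- parents. Down twice forces the walk to keep descending, so it cannot return to `x`.
  parentGraph-acyclic : ∀ x vs → ¬ IsCycle parentGraph x vs
  parentGraph-acyclic x (_ ∷ []) (s≤s () , _)
  parentGraph-acyclic x (v ∷ w ∷ vs) (_ , x≢ ∷ distinct@(v≢ ∷ _) , inj₁ x↑v ∷ walk)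
    with climb vs walk distinct x≢
  ... | inj₁ x<v             = ℕₚ.<-asym x<v (up-rank x↑v)
  ... | inj₂ (y , y∈ , x↑y) = All.lookup v≢ y∈ (up-unique x↑v x↑y)
  parentGraph-acyclic x (v ∷ w ∷ vs) (_ , (_ ∷ x≢w ∷ _) ∷ _ , inj₂ v↑x ∷ inj₁ v↑w ∷ _) =
    x≢w (up-unique v↑x v↑w)
  parentGraph-acyclic x (v ∷ w ∷ vs) (_ , x≢ ∷ distinct , inj₂ v↑x ∷ inj₂ w↑v ∷ walk)
    with w<x , _ ← descend vs w↑v walk distinct x≢ =
    ℕₚ.<-asym w<x (ℕₚ.<-trans (up-rank v↑x) (up-rank w↑v))

  parentGraph-isTree : ∀ {r} → (∀ {x} → Root x → x ≡ r) → IsTreeOn ⊤ parentGraph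
  parentGraph-isTree {r} root-unique = record
    { within    = λ _ → ∈⊤ , ∈⊤
    ; connected = λ {x} {y} _ _ →
        to-root x (<-wellFounded _) ◅◅ Star.reverse Sum.swap (to-root y (<-wellFounded _))
    ; acyclic   = parentGraph-acyclic
    }
    where
    to-root : ∀ x → Acc ℕ._<_ (rank x) → Star (Adj parentGraph) x r
    to-root x (acc rec) with Root? x
    ... | yes root with ≡.refl ← root-unique root = ε
    ... | no ¬root = inj₁ (¬root , ≡.refl) ◅ to-root (parent x) (rec (rank-< ¬root))

-- Feasible sets and the contracted graph.

module ForestCompletion {c ℓ₁ ℓ₂} (R : Reals c ℓ₁ ℓ₂) {n t} (I : MFCInput R n t) where
  open Reals R
  open MFCInput I
  open IsPartition isPartition
  open OrderedFieldProperties orderedField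
  open ListSums orderedField
  open ≤-Reasoning
  open IsGeneralMetric isMetric public using (triangle) renaming (sym to d-sym)
  open GraphWeight R d

  d-nonneg : ∀ x y → 0# ≤ʳ d x y
  d-nonneg x y = IsGeneralMetric.nonNegative isMetric

  d-self : ∀ x → d x x ≈ 0#
  d-self x = IsGeneralMetric.≈⇒0 isMetric ≡.refl

  Eₜ-within : ∀ {x y i} → x ∈ₛ P i → Adj Eₜ x y → y ∈ₛ P i
  Eₜ-within x∈ (j , xy) with x∈j , y∈j ← IsTreeOn.within (isTree j) xy
    with ≡.refl ← disjoint x∈ x∈j = y∈j

  Eₜ-connects : ∀ {x y i} → x ∈ₛ P i → y ∈ₛ P i → Star (Adj Eₜ) x y
  Eₜ-connects {i = i} x∈ y∈ = Star.map (i ,_) (IsTreeOn.connected (isTree i) x∈ y∈)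

  module _ {M : Graph n} (M-feasible : Feasible M) where
    crosses : ∀ {x y i j} → x ∈ₛ P i → y ∈ₛ P j → Adj M x y → i ≢ j
    crosses x∈ y∈ xy ≡.refl with i′ , j′ , i′≢j′ , x∈′ , y∈′ ← proj₁ M-feasible xy =
      i′≢j′ (≡.trans (disjoint x∈′ x∈) (disjoint y∈ y∈′))

    Eₜ-disjoint : ∀ {x y} → Adj Eₜ x y → ¬ Adj M x y
    Eₜ-disjoint {x} e m with i , x∈ ← cover x = crosses x∈ (Eₜ-within x∈ e) m ≡.refl

    weight-Eₜ∪ : w𝒳 Eₜ + w𝒳 M ≤ʳ w𝒳 (Eₜ ∪ M)
    weight-Eₜ∪ = weight-∪-disjoint d-sym d-nonneg Eₜ M Eₜ-disjoint

    quotient : Graph t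
    quotient = record
      { Adj    = λ i j → ∃₂ λ x y → x ∈ₛ P i × y ∈ₛ P j × Adj M x y
      ; adj?   = λ i j → any? λ x → any? λ y → x ∈? P i ×-dec y ∈? P j ×-dec adj? M x y
      ; sym    = λ (x , y , x∈ , y∈ , xy) → y , x , y∈ , x∈ , Graph.sym M xy
      ; irrefl = λ { ≡.refl (x , y , x∈ , y∈ , xy) → crosses x∈ y∈ xy ≡.refl }
      }

    quotient-star : ∀ {x y i j} → x ∈ₛ P i → y ∈ₛ P j →
                    Star (Adj (Eₜ ∪ M)) x y → Star (Adj quotient) i j
    quotient-star x∈ y∈ ε with ≡.refl ← disjoint x∈ y∈ = ε
    quotient-star x∈ y∈ (inj₁ e ◅ p) = quotient-star (Eₜ-within x∈ e) y∈ p
    quotient-star x∈ y∈ (_◅_ {j = z} (inj₂ m) p) with k , z∈ ← cover z =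
      (_ , z , x∈ , z∈ , m) ◅ quotient-star z∈ y∈ p

    quotient-connected : ∀ i j → Star (Adj quotient) i j
    quotient-connected i j with x , x∈ ← nonempty i with y , y∈ ← nonempty j =
      quotient-star x∈ y∈ (proj₂ M-feasible ∈⊤ ∈⊤)

  -- Distances to the representatives, paid by the given trees.

  module _ (s : Fin t → Fin n) (s∈P : ∀ i → s i ∈ₛ P i) where
    private
      IsRep : Pred (Fin n) 0ℓ
      IsRep x = ∃[ i ] x ≡ s i

      isRep? : Decidable IsRep
      isRep? x = any? λ i → x ≟ s i

      rep-reaches : ∀ x → ∃[ r ] IsRep r × Star (Adj Eₜ) r x
      rep-reaches x with i , x∈ ← cover x = s i , (i , ≡.refl) , Eₜ-connects (s∈P i) x∈

    -- One forest rooted at all representatives serves every tree at once: edges of `Eₜ` stay inside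
    -- components, so the parents of a node of `P i` lead to `s i`.
    open SpanningForest (spanningForest Eₜ isRep? rep-reaches)

    private
      link : Fin n → Carrier
      link v = d v (parent v)

      -- The list consists of `x` and its ancestors below the representative. The rank clause is
      -- there for the recursion, where it keeps `x` apart from its ancestors.
      root-path : ∀ {i x} → Acc ℕ._<_ (rank x) → x ∈ₛ P i → ∃[ vs ] Unique vs ×
        (∀ {v} → v ∈ vs → v ∈ₛ P i × ¬ IsRep v × rank v ℕ.≤ rank x) × d (s i) x ≤ʳ ∑ vs link
      root-path {i} {x} (acc rec) x∈ with isRep? x
      ... | yes (j , ≡.refl) with ≡.refl ← disjoint x∈ (s∈P j) =
        [] , [] , (λ ()) , ≤-reflexive (d-self x)
      ... | no ¬rep
        with vs , vs! , vs-in , le ← root-path (rec (rank-< ¬rep)) (Eₜ-within x∈ (parent-adj ¬rep)) =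
        x ∷ vs , All.tabulate x∉vs ∷ vs! , x∷vs-in , (begin
          d (s i) x                            ≤⟨ triangle _ _ _ ⟩
          d (s i) (parent x) + d (parent x) x  ≤⟨ +-monoˡ-≤ _ le ⟩
          ∑ vs link + d (parent x) x           ≈⟨ +-congˡ (d-sym _ _) ⟩
          ∑ vs link + link x                   ≈⟨ +-comm _ _ ⟩
          link x + ∑ vs link                   ∎)
        where
        below : ∀ {v} → v ∈ vs → rank v ℕ.< rank x
        below v∈ = ℕₚ.≤-<-trans (proj₂ (proj₂ (vs-in v∈))) (rank-< ¬rep)

        x∉vs : ∀ {v} → v ∈ vs → x ≢ v
        x∉vs v∈ ≡.refl = ℕₚ.<-irrefl ≡.refl (below v∈)

        x∷vs-in : ∀ {v} → v ∈ x ∷ vs → v ∈ₛ P i × ¬ IsRep v × rank v ℕ.≤ rank x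
        x∷vs-in (here ≡.refl) = x∈ , ¬rep , ℕₚ.≤-refl
        x∷vs-in (there v∈) with v∈P , ¬rep-v , _ ← vs-in v∈ = v∈P , ¬rep-v , ℕₚ.<⇒≤ (below v∈)

      Below : Pred (Fin t × Fin n) 0ℓ
      Below (i , v) = v ∈ₛ P i × ¬ IsRep v

      below? : Decidable Below
      below? (i , v) = v ∈? P i ×-dec ¬? (isRep? v)

      -- The path is enlarged to all links of the component, so that the bound depends on the
      -- component alone.
      d-rep-≤ : ∀ {i x} → x ∈ₛ P i →
                d (s i) x ≤ʳ ∑ (filter (λ v → below? (i , v)) (allFin n)) link
      d-rep-≤ {i} {x} x∈ with vs , vs! , vs-in , le ← root-path (<-wellFounded (rank x)) x∈ =
        ≤-trans le (∑-injection-≤ _≡_ vs! (λ _ → d-nonneg _ _) image (λ { _ _ ≡.refl ≡.refl → ≡.refl }))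
        where
        image : ∀ {v} → v ∈ vs →
                ∃[ u ] u ∈ filter (λ v → below? (i , v)) (allFin n) × v ≡ u × link v ≤ʳ link u
        image {v} v∈ with v∈P , ¬rep , _ ← vs-in v∈ =
          v , ∈-filter⁺ (λ v → below? (i , v)) (∈-allFin v) (v∈P , ¬rep) , ≡.refl , ≤-refl

    -- Links starting at different nodes are different edges of `Eₜ`: coinciding in reverse, they
    -- would make two nodes parents of each other, against the rank. With `Unique ks`, no edge is
    -- paid twice.
    ∑-d-rep-≤ : ∀ (x : Fin t → Fin n) {ks} → Unique ks → (∀ {k} → k ∈ ks → x k ∈ₛ P k) →
                ∑ ks (λ k → d (s k) (x k)) ≤ʳ w𝒳 Eₜ
    ∑-d-rep-≤ x {ks} ks! x∈P = begin
      ∑ ks (λ k → d (s k) (x k))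
        ≤⟨ ∑-mono-≤ ks (d-rep-≤ ∘ x∈P) ⟩
      ∑ ks (λ k → ∑ (filter (λ v → below? (k , v)) (allFin n)) link)
        ≈⟨ ∑-filter-cartesianProduct below? ks (allFin n) (link ∘ proj₂) ⟨
      ∑ (filter below? (cartesianProduct ks (allFin n))) (link ∘ proj₂)
        ≤⟨ ∑-≤-weight d-sym d-nonneg {G = Eₜ} (λ (_ , v) → v , parent v)
             (Uniqueₚ.filter⁺ below? (Uniqueₚ.cartesianProduct⁺ ks! (Uniqueₚ.allFin⁺ n)))
             (parent-adj ∘ proj₂ ∘ below)
             (λ p q → links-distinct (below p) (below q)) ⟩
      w𝒳 Eₜ ∎
      where
      below : ∀ {kv} → kv ∈ filter below? (cartesianProduct ks (allFin n)) → Below kv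
      below = proj₂ ∘ ∈-filter⁻ below? {xs = cartesianProduct ks (allFin n)}

      links-distinct : ∀ {k v k′ v′} → Below (k , v) → Below (k′ , v′) →
                       (v , parent v) ≐ (v′ , parent v′) → (k , v) ≡ (k′ , v′)
      links-distinct {v = v} {v′ = v′} (v∈ , ¬rep) (v′∈ , ¬rep′) (inj₁ eq)
        with ≡.refl ← ≡.cong proj₁ eq with ≡.refl ← disjoint v∈ v′∈ = ≡.refl
      links-distinct (v∈ , ¬rep) (v′∈ , ¬rep′) (inj₂ eq) = contradiction (rank-< ¬rep)
        (ℕₚ.<-asym (≡.subst₂ (λ u u′ → rank u ℕ.< rank u′)
          (≡.sym (≡.cong proj₁ eq)) (≡.sym (≡.cong proj₂ eq)) (rank-< ¬rep′)))

  -- The cost of a run of the algorithm.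

  module _ (run : MFCApproxRun R I) where
    open MFCApproxRun run
    private module ŵ-Weight = GraphWeight R ŵ

    ŵ-≤ʳ : ∀ {i j x} → i ≢ j → x ∈ₛ P i → ŵ i j ≤ʳ d x (s j)
    ŵ-≤ʳ {i} {j} {x} i≢j x∈ = ≤-trans (proj₂ (ŵ-least i j i≢j) _ (inj₁ refl))
      (proj₂ (w→-least i j i≢j) _ (x , x∈ , refl))

    -- The counterpart of `ŵ-≤ʳ`: edges are weighed at their increasing pair, so the child in an
    -- edge of the contracted tree may be either index.
    ŵ-≤ˡ : ∀ {i j x} → i ≢ j → x ∈ₛ P j → ŵ i j ≤ʳ d x (s i)
    ŵ-≤ˡ {i} {j} {x} i≢j x∈ = ≤-trans (proj₂ (ŵ-least i j i≢j) _ (inj₂ refl))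
      (proj₂ (w→-least j i (≡.≢-sym i≢j)) _ (x , x∈ , refl))

    -- Recorded pairs cost exactly `ŵ`. Stating an inequality spares a proof that distinct edges of
    -- `T̂𝒫` record distinct pairs.
    weight-M̂≤weight-T̂𝒫 : w𝒳 M̂ ≤ʳ weight R ŵ T̂𝒫
    weight-M̂≤weight-T̂𝒫 = ≤-trans
      (weight-≤-∑ {G = M̂} {xs = edges T̂𝒫} (uncurry recorded) ŵ-nonneg covered)
      (≤-reflexive (sym (ŵ-Weight.weight≈∑ T̂𝒫)))
      where
      attained : ∀ {i j} → i < j → d (proj₁ (recorded i j)) (proj₂ (recorded i j)) ≈ ŵ i j
      attained i<j = proj₂ (recorded-attains _ _ i<j)

      ŵ-nonneg : ∀ {ij} → ij ∈ edges T̂𝒫 → 0# ≤ʳ uncurry ŵ ij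
      ŵ-nonneg ij∈ = ≤-trans (d-nonneg _ _) (≤-reflexive (attained (proj₁ (∈-edges⁻ T̂𝒫 ij∈))))

      covered : ∀ {x y} → x < y → Adj M̂ x y →
        ∃[ ij ] ij ∈ edges T̂𝒫 × uncurry recorded ij ≐ (x , y) × d x y ≤ʳ uncurry ŵ ij
      covered _ (i , j , i<j , ij , inj₁ eq) = (i , j) , ∈-edges⁺ T̂𝒫 i<j ij , inj₁ eq ,
        ≤-reflexive (≡.subst (λ e → uncurry d e ≈ ŵ i j) eq (attained i<j))
      covered _ (i , j , i<j , ij , inj₂ eq) = (i , j) , ∈-edges⁺ T̂𝒫 i<j ij , inj₂ eq ,
        ≤-reflexive (trans (d-sym _ _) (≡.subst (λ e → uncurry d e ≈ ŵ i j) eq (attained i<j)))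

    M̂-feasible : Feasible M̂
    M̂-feasible = crossing , λ {x} {y} _ _ →
      connect (proj₂ (cover x)) (proj₂ (cover y)) (IsTreeOn.connected (proj₁ T̂𝒫-isMST) ∈⊤ ∈⊤)
      where
      crossing : ∀ {x y} → Adj M̂ x y → ∃₂ λ i j → i ≢ j × x ∈ₛ P i × y ∈ₛ P j
      crossing (i , j , i<j , _ , inj₁ eq) with x∈ , y∈ ← recorded∈P i j i<j =
        i , j , <⇒≢ i<j ,
        ≡.subst (_∈ₛ P i) (≡.cong proj₁ eq) x∈ , ≡.subst (_∈ₛ P j) (≡.cong proj₂ eq) y∈
      crossing (i , j , i<j , _ , inj₂ eq) with x∈ , y∈ ← recorded∈P i j i<j =
        j , i , ≡.≢-sym (<⇒≢ i<j) ,
        ≡.subst (_∈ₛ P j) (≡.cong proj₂ eq) y∈ , ≡.subst (_∈ₛ P i) (≡.cong proj₁ eq) x∈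

      link : ∀ {i j} → Adj T̂𝒫 i j → ∃₂ λ x y → x ∈ₛ P i × y ∈ₛ P j × Adj M̂ x y
      link {i} {j} ij with <-cmp i j
      ... | tri< i<j _ _ = _ , _ , proj₁ (recorded∈P i j i<j) , proj₂ (recorded∈P i j i<j) ,
                           (i , j , i<j , ij , inj₁ ≡.refl)
      ... | tri≈ _ i≡j _ = contradiction ij (Graph.irrefl T̂𝒫 i≡j)
      ... | tri> _ _ j<i = _ , _ , proj₂ (recorded∈P j i j<i) , proj₁ (recorded∈P j i j<i) ,
                           (j , i , j<i , Graph.sym T̂𝒫 ij , inj₂ ≡.refl)

      connect : ∀ {x y i j} → x ∈ₛ P i → y ∈ₛ P j → Star (Adj T̂𝒫) i j → Star (Adj (Eₜ ∪ M̂)) x y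
      connect x∈ y∈ ε = Star.map inj₁ (Eₜ-connects x∈ y∈)
      connect x∈ y∈ (ik ◅ kj) with u , v , u∈ , v∈ , uv ← link ik =
        Star.map inj₁ (Eₜ-connects x∈ u∈) ◅◅ inj₂ uv ◅ connect v∈ y∈ kj

    module _ {M : Graph n} (M-feasible : Feasible M) (r : Fin t) where
      open SpanningForest (spanningForest (quotient {M} M-feasible) (_≟ r)
        (λ i → r , ≡.refl , quotient-connected {M} M-feasible r i))
      open ParentGraph (_≟ r) parent rank rank-<

      private
        nonRoots : List (Fin t)
        nonRoots = filter (λ k → ¬? (k ≟ r)) (allFin t)

        nonRoots! : Unique nonRoots
        nonRoots! = Uniqueₚ.filter⁺ (λ k → ¬? (k ≟ r)) (Uniqueₚ.allFin⁺ t)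

        ∈-nonRoots⁺ : ∀ {k} → k ≢ r → k ∈ nonRoots
        ∈-nonRoots⁺ {k} = ∈-filter⁺ (λ k → ¬? (k ≟ r)) (∈-allFin k)

        ∈-nonRoots⁻ : ∀ {k} → k ∈ nonRoots → k ≢ r
        ∈-nonRoots⁻ = proj₂ ∘ ∈-filter⁻ (λ k → ¬? (k ≟ r)) {xs = allFin t}

        parent≢ : ∀ {k} → k ≢ r → k ≢ parent k
        parent≢ k≢r eq = ℕₚ.<-irrefl (≡.cong rank (≡.sym eq)) (rank-< k≢r)

        -- At the root the chosen pair carries no meaning.
        crossing : ∀ k → ∃[ (x , y) ] (k ≢ r → x ∈ₛ P k × y ∈ₛ P (parent k) × Adj M x y)
        crossing k with k ≟ r
        ... | yes k≡r = (s k , s k) , λ k≢r → contradiction k≡r k≢r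
        ... | no  k≢r with x , y , xy ← parent-adj k≢r = (x , y) , λ _ → xy

        near far : Fin t → Fin n
        near k = proj₁ (proj₁ (crossing k))
        far  k = proj₂ (proj₁ (crossing k))

        near∈ : ∀ {k} → k ≢ r → near k ∈ₛ P k
        near∈ {k} k≢r = proj₁ (proj₂ (crossing k) k≢r)

        far∈ : ∀ {k} → k ≢ r → far k ∈ₛ P (parent k)
        far∈ {k} k≢r = proj₁ (proj₂ (proj₂ (crossing k) k≢r))

        detour : Fin t → Carrier
        detour k = d (s k) (near k) + d (near k) (far k)

        detour-bound : ∀ k → d (far k) (s k) ≤ʳ detour k
        detour-bound k = ≤-trans (≤-reflexive (d-sym _ _)) (triangle _ _ _)

        weight-parentGraph : weight R ŵ parentGraph ≤ʳ ∑ nonRoots detour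
        weight-parentGraph = ŵ-Weight.weight-≤-∑ {G = parentGraph} {xs = nonRoots}
          (λ k → k , parent k) (λ _ → +-nonneg (d-nonneg _ _) (d-nonneg _ _)) λ where
            _ (inj₁ (i≢r , ≡.refl)) → _ , ∈-nonRoots⁺ i≢r , inj₁ ≡.refl ,
              ≤-trans (ŵ-≤ˡ (parent≢ i≢r) (far∈ i≢r)) (detour-bound _)
            _ (inj₂ (j≢r , ≡.refl)) → _ , ∈-nonRoots⁺ j≢r , inj₂ ≡.refl ,
              ≤-trans (ŵ-≤ʳ (≡.≢-sym (parent≢ j≢r)) (far∈ j≢r)) (detour-bound _)

        -- An edge of `M` determines the two components it joins. Two children sharing it are thus
        -- equal or each other's parent, and the rank excludes the latter.
        ∑-crossings : ∑ nonRoots (λ k → d (near k) (far k)) ≤ʳ w𝒳 M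
        ∑-crossings = ∑-≤-weight d-sym d-nonneg {G = M} (proj₁ ∘ crossing) nonRoots!
          (λ {k} k∈ → proj₂ (proj₂ (proj₂ (crossing k) (∈-nonRoots⁻ k∈))))
          (λ k∈ l∈ → crossings-distinct (∈-nonRoots⁻ k∈) (∈-nonRoots⁻ l∈))
          where
          crossings-distinct : ∀ {k l} → k ≢ r → l ≢ r → (near k , far k) ≐ (near l , far l) → k ≡ l
          crossings-distinct {k} {l} k≢r l≢r (inj₁ eq) =
            disjoint (near∈ k≢r) (≡.subst (_∈ₛ P l) (≡.sym (≡.cong proj₁ eq)) (near∈ l≢r))
          crossings-distinct {k} {l} k≢r l≢r (inj₂ eq) = contradiction
            (≡.subst (λ m → rank m ℕ.< rank l) (≡.sym k≡parent-l) (rank-< l≢r))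
            (ℕₚ.<-asym (≡.subst (λ m → rank m ℕ.< rank k) parent-k≡l (rank-< k≢r)))
            where
            k≡parent-l : k ≡ parent l
            k≡parent-l = disjoint (near∈ k≢r)
              (≡.subst (_∈ₛ P (parent l)) (≡.sym (≡.cong proj₁ eq)) (far∈ l≢r))

            parent-k≡l : parent k ≡ l
            parent-k≡l = disjoint (≡.subst (_∈ₛ P (parent k)) (≡.cong proj₂ eq) (far∈ k≢r))
              (near∈ l≢r)

      weight-T̂𝒫≤ : weight R ŵ T̂𝒫 ≤ʳ w𝒳 Eₜ + w𝒳 M
      weight-T̂𝒫≤ = begin
        weight R ŵ T̂𝒫
          ≤⟨ proj₂ T̂𝒫-isMST parentGraph (parentGraph-isTree id) ⟩
        weight R ŵ parentGraph
          ≤⟨ weight-parentGraph ⟩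
        ∑ nonRoots detour
          ≈⟨ ∑-+ nonRoots (λ k → d (s k) (near k)) (λ k → d (near k) (far k)) ⟩
        ∑ nonRoots (λ k → d (s k) (near k)) + ∑ nonRoots (λ k → d (near k) (far k))
          ≤⟨ +-mono-≤ (∑-d-rep-≤ s s∈P near nonRoots! (near∈ ∘ ∈-nonRoots⁻)) ∑-crossings ⟩
        w𝒳 Eₜ + w𝒳 M ∎

    -- Without components there is no root to hang the tree from, but then
    -- nothing is to be paid either.
    weight-M̂≤ : ∀ {M} → Feasible M → w𝒳 M̂ ≤ʳ w𝒳 Eₜ + w𝒳 M
    weight-M̂≤ {M} M-feasible = ≤-trans weight-M̂≤weight-T̂𝒫 (by-root t ≡.refl)
      where
      by-root : ∀ t′ → t ≡ t′ → weight R ŵ T̂𝒫 ≤ʳ w𝒳 Eₜ + w𝒳 M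
      by-root zero    ≡.refl = +-nonneg (weight-nonneg d-sym d-nonneg Eₜ) (weight-nonneg d-sym d-nonneg M)
      by-root (suc _) ≡.refl = weight-T̂𝒫≤ {M} M-feasible Fin.zero

    module _ {M* : Graph n} (M*-optimal : Optimal M*) where
      private
        M*-feasible : Feasible M*
        M*-feasible = proj₁ M*-optimal

        T* : Graph n
        T* = Eₜ ∪ M*

      -- Optimality compares sums of weights, not weights of unions. Subadditivity passes from one
      -- to the other for `M*`; for `M̂` it takes disjointness from `Eₜ`, which feasibility
      -- provides.
      weight-T*≤weight-T̂ : w𝒳 T* ≤ʳ w𝒳 T̂
      weight-T*≤weight-T̂ = begin
        w𝒳 T*          ≤⟨ weight-∪-≤ d-sym d-nonneg Eₜ M* ⟩
        w𝒳 Eₜ + w𝒳 M*  ≈⟨ +-comm _ _ ⟩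
        w𝒳 M* + w𝒳 Eₜ  ≤⟨ proj₂ M*-optimal M̂ M̂-feasible ⟩
        w𝒳 M̂ + w𝒳 Eₜ   ≈⟨ +-comm _ _ ⟩
        w𝒳 Eₜ + w𝒳 M̂   ≤⟨ weight-Eₜ∪ {M̂} M̂-feasible ⟩
        w𝒳 T̂           ∎

      weight-T̂≤2*weight-T* : w𝒳 T̂ ≤ʳ fromℕ 2 * w𝒳 T*
      weight-T̂≤2*weight-T* = begin
        w𝒳 T̂                      ≤⟨ weight-∪-≤ d-sym d-nonneg Eₜ M̂ ⟩
        -- The trees are paid twice, as part of `T̂` and for the detours. The bound is then
        -- `2 w(Eₜ) + w(M*)`, and replacing one `w(Eₜ)` by `w(T*)` gives away a further `w(M*)`.
        w𝒳 Eₜ + w𝒳 M̂              ≤⟨ +-mono-≤ weight-Eₜ≤ (weight-M̂≤ {M*} M*-feasible) ⟩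
        w𝒳 T* + (w𝒳 Eₜ + w𝒳 M*)   ≤⟨ +-monoʳ-≤ _ (weight-Eₜ∪ {M*} M*-feasible) ⟩
        w𝒳 T* + w𝒳 T*             ≈⟨ 2*-double (w𝒳 T*) ⟨
        fromℕ 2 * w𝒳 T*           ∎
        where
        weight-Eₜ≤ : w𝒳 Eₜ ≤ʳ w𝒳 T*
        weight-Eₜ≤ = begin
          w𝒳 Eₜ          ≈⟨ +-identityʳ _ ⟨
          w𝒳 Eₜ + 0#     ≤⟨ +-monoʳ-≤ _ (weight-nonneg d-sym d-nonneg M*) ⟩
          w𝒳 Eₜ + w𝒳 M*  ≤⟨ weight-Eₜ∪ {M*} M*-feasible ⟩
          w𝒳 T*          ∎

theorem4p2 : ∀ {c ℓ₁ ℓ₂} (R : Reals c ℓ₁ ℓ₂) → let open Reals R in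
    ∀ {n t} (I : MFCInput R n t) → let open MFCInput I in
    ∀ (M* : Graph n) → Optimal M* → let T* = Eₜ ∪ M* in
    ∀ (run : MFCApproxRun R I) → let open MFCApproxRun run in
    ∀ (√5 : Carrier) → IsSqrt (fromℕ 5) √5 → let β = (fromℕ 3 + √5) / 2 in
    (w𝒳 T* ≤ʳ w𝒳 T̂) × (w𝒳 T̂ ≤ʳ β * w𝒳 T*) × (β <ʳ fromℕ 262 / 100)
theorem4p2 R I M* M*-optimal run √5 √5-isSqrt =
  weight-T*≤weight-T̂ run {M*} M*-optimal ,
  ≤-trans (weight-T̂≤2*weight-T* run {M*} M*-optimal)
    (*-monoʳ-≤-nonneg (weight-nonneg d-sym d-nonneg (Eₜ ∪ M*)) (2<[3+√5]/2 √5-isSqrt)) ,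
  [3+√5]/2<2·62 √5-isSqrt
  where
  open Reals R
  open MFCInput I
  open OrderedFieldProperties orderedField
  open ForestCompletion R I
  open GraphWeight R d using (weight-nonneg)
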